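{- Let \[ U=\{(a,b)\in(\mathbb{Z}[i]\setminus\{0\})^2: ab\in\{1,\,2,\,3,\,\pm i,\, 1\pm i,\,2\pm i,\, 3\pm i,\,1\pm 2i,\, 2\pm 2i,\, 3\pm 2i\}\}\cup\{0\} \] and \[ U_1=\left\{\begin{aligned} &\{1,1\}, \{1,2\}, \{1,3\}, \{1,i\}, \{1,1+i\}, \{1,2+i\}, \{1,3+i\},\\ &\{1,1+2i\}, \{1,2+2i\}, \{1+i,1-i\}, \{1+i,2\}, \{1+i,2-i\} \end{aligned}\right\}. \] Then $\mathrm{Ex}(\overline{U_1})\subsetneq \mathrm{Ex}(U)$.
   Context: For a sequence of Gaussian integers $b_0,b_1,\dots$, $[b_0,b_1,\dots]$ denotes the (negative) Gaussian integer continued fraction $b_0-\cfrac{1}{b_1-\cfrac{1}{b_2-\cdots}}$; here it is regarded as the formal object determined by its coefficient sequence. A word is a nonempty finite sequence of Gaussian integers $(x_1,\dots,x_n)$; a word of length one is written $x_1$ (so $0$ denotes the one-letter word with entry $0$). A word $x$ is a substring of $[b_0,b_1,\dots]$ if $x=(b_r,b_{r+1},\dots,b_s)$ for some $0\leq r\leq s$ (contiguous). For a set $X$ of words and a unit $u\in\{\pm1,\pm i\}$, the operation $X\to X^u$ replaces each word $(x_1,x_2,\dots,x_n)$ of $X$ with $(ux_1,u^{ -1}x_2,\dots,u^{(-1)^{n-1}}x_n)$. $\overline{X}$ is the smallest set of words in $\mathbb{Z}[i]$ that contains $X$ and the one-letter word $0$ and is closed under (entrywise) complex conjugation and under all operations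 $X\to X^u$, for every unit $u$. $X$ is symmetric if $X=\overline{X}$. For a symmetric set $X$, $\mathrm{Ex}(X)$ is the set of all infinite Gaussian integer continued fractions $[b_0,b_1,\dots]$ for which every tail $[b_n,b_{n+1},\dots]$ contains a substring from $X$. Sets of words closed under reversal are written as collections of multisets: the multiset $\{a,b\}$ stands for both words $(a,b)$ and $(b,a)$. -}

module Defs where

open import Agda.Builtin.FromNat using (Number; fromNat)
open import Data.Integer.Base as ℤ using (ℤ; +_; 0ℤ; 1ℤ)
open import Data.List.Base using (List; []; _∷_; applyUpTo)
open import Data.List.Membership.Propositional using (_∈_)
open import Data.List.NonEmpty.Base as List⁺ using (List⁺; _∷_; [_])
open import Data.Nat.Base as ℕ using (ℕ; suc)
open import Data.Product.Base using (_×_; _,_; ∃-syntax)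
open import Data.Unit.Base using (⊤; tt)
open import Level using (0ℓ)
open import Relation.Binary.PropositionalEquality using (_≡_; _≢_)
open import Relation.Unary using (Pred)

------------------------------------------------------------------------
-- Gaussian integers

record ℤ[i] : Set where
  constructor gauss
  field
    re im : ℤ

open ℤ[i] public

infixl 7 _*_
infixl 6 _+_ _-_
infix  8 -_

_+_ : ℤ[i] → ℤ[i] → ℤ[i]
gauss a b + gauss c d = gauss (a ℤ.+ c) (b ℤ.+ d)

-_ : ℤ[i] → ℤ[i]
- gauss a b = gauss (ℤ.- a) (ℤ.- b)

_-_ : ℤ[i] → ℤ[i] → ℤ[i]
x - y = x + - y

_*_ : ℤ[i] → ℤ[i] → ℤ[i]
gauss a b * gauss c d = gauss (a ℤ.* c ℤ.- b ℤ.* d) (a ℤ.* d ℤ.+ b ℤ.* c)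

conj : ℤ[i] → ℤ[i]
conj (gauss a b) = gauss a (ℤ.- b)

i : ℤ[i]
i = gauss 0ℤ 1ℤ

-- Numerals may denote Gaussian integers.
instance
  numberℤ[i] : Number ℤ[i]
  numberℤ[i] = record
    { Constraint = λ _ → ⊤
    ; fromNat    = λ n → gauss (+ n) 0ℤ
    }

data Unit : Set where
  u₁ u₋₁ uᵢ u₋ᵢ : Unit

⟦_⟧ : Unit → ℤ[i]
⟦ u₁  ⟧ = 1
⟦ u₋₁ ⟧ = - 1
⟦ uᵢ  ⟧ = i
⟦ u₋ᵢ ⟧ = - i

infix 9 _⁻¹

_⁻¹ : Unit → Unit
u₁  ⁻¹ = u₁
u₋₁ ⁻¹ = u₋₁
uᵢ  ⁻¹ = u₋ᵢ
u₋ᵢ ⁻¹ = uᵢ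

------------------------------------------------------------------------
-- Words

Word : Set
Word = List⁺ ℤ[i]

WordSet : Set₁
WordSet = Pred Word 0ℓ

-- (x₁ , x₂ , x₃ , …) ↦ (u x₁ , u⁻¹ x₂ , u x₃ , …)
twistList : Unit → List ℤ[i] → List ℤ[i]
twistList u []       = []
twistList u (x ∷ xs) = ⟦ u ⟧ * x ∷ twistList (u ⁻¹) xs

twist : Unit → Word → Word
twist u (x ∷ xs) = ⟦ u ⟧ * x ∷ twistList (u ⁻¹) xs

data Closure (X : WordSet) : WordSet where
  base   : ∀ {w} → X w → Closure X w
  zero   : Closure X [ 0 ]
  conj∈  : ∀ {w} → Closure X w → Closure X (List⁺.map conj w)
  twist∈ : ∀ {w} (u : Unit) → Closure X w → Closure X (twist u w)

------------------------------------------------------------------------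
-- Continued fractions, as formal coefficient sequences

ContinuedFraction : Set
ContinuedFraction = ℕ → ℤ[i]

tailFrom : ℕ → ContinuedFraction → ContinuedFraction
tailFrom n b k = b (n ℕ.+ k)

-- For r ≤ s, this is (b r , b (r + 1) , … , b s).
slice : ContinuedFraction → ℕ → ℕ → Word
slice b r s = b r ∷ applyUpTo (λ k → b (suc (r ℕ.+ k))) (s ℕ.∸ r)

Substring : Word → ContinuedFraction → Set
Substring w b = ∃[ r ] ∃[ s ] r ℕ.≤ s × w ≡ slice b r s

-- Intended for symmetric X, that is, X equal to Closure X.
Ex : WordSet → Pred ContinuedFraction 0ℓ
Ex X b = ∀ n → ∃[ w ] X w × Substring w (tailFrom n b)

------------------------------------------------------------------------
-- The sets U and U₁

products : List ℤ[i]
products =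
  1 ∷ 2 ∷ 3 ∷
  i ∷ - i ∷
  1 + i ∷ 1 - i ∷
  2 + i ∷ 2 - i ∷
  3 + i ∷ 3 - i ∷
  1 + 2 * i ∷ 1 - 2 * i ∷
  2 + 2 * i ∷ 2 - 2 * i ∷
  3 + 2 * i ∷ 3 - 2 * i ∷
  []

data U : WordSet where
  pair : ∀ {a b} → a ≢ 0 → b ≢ 0 → a * b ∈ products → U (a ∷ b ∷ [])
  zero : U [ 0 ]

multisets₁ : List (ℤ[i] × ℤ[i])
multisets₁ =
  (1 , 1) ∷ (1 , 2) ∷ (1 , 3) ∷ (1 , i) ∷ (1 , 1 + i) ∷ (1 , 2 + i) ∷
  (1 , 3 + i) ∷ (1 , 1 + 2 * i) ∷ (1 , 2 + 2 * i) ∷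
  (1 + i , 1 - i) ∷ (1 + i , 2) ∷ (1 + i , 2 - i) ∷ []

data U₁ : WordSet where
  forward  : ∀ {a b} → (a , b) ∈ multisets₁ → U₁ (a ∷ b ∷ [])
  backward : ∀ {a b} → (a , b) ∈ multisets₁ → U₁ (b ∷ a ∷ [])

{-# OPTIONS --safe #-}
module Submission where

-- Twisting preserves the product of a two-letter word and conjugation
-- conjugates it, so the two-letter words of the closure of U₁ are recognised
-- by their products.  These lie in products but never equal 3 ± 2i, so
-- [1, 3 + 2i, 1, 3 + 2i, …] is in Ex U and not in Ex (Closure U₁).

open import Defs
open import Agda.Builtin.FromNat using (Number; fromNat)
open import Data.Integer.Base as ℤ using (0ℤ; 1ℤ)
import Data.Integer.Properties as ℤ
open import Data.Integer.Tactic.RingSolver using (solve-∀)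
open import Data.List.Base using (List; []; _∷_; take)
open import Data.List.Membership.Propositional using (_∈_)
import Data.List.Membership.DecPropositional as DecMembership
open import Data.List.NonEmpty.Base as List⁺ using (_∷_; [_])
open import Data.List.Properties using (∷-injectiveˡ)
open import Data.List.Relation.Unary.All as All using (All)
open import Data.Nat.Base as ℕ using (ℕ; zero; suc; z≤n)
import Data.Nat.Literals as ℕ
import Data.Nat.Properties as ℕ
open import Data.Product.Base using (_×_; _,_; ∃-syntax; uncurry)
open import Data.Unit.Base using (tt)
open import Function.Base using (_∘_)
open import Relation.Binary.Definitions using (DecidableEquality)
open import Relation.Binary.PropositionalEquality
  using (_≡_; _≢_; refl; sym; trans; cong; cong₂; subst; module ≡-Reasoning)
open import Relation.Nullary using (¬_; ¬?; _×-dec_; contradiction; from-yes; from-no)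
open import Relation.Nullary.Decidable using (map′)
open import Relation.Unary using (_⊂_; _⊆_)

instance
  numberℕ : Number ℕ
  numberℕ = ℕ.number

infix 4 _≟_

_≟_ : DecidableEquality ℤ[i]
gauss a b ≟ gauss c d =
  map′ (uncurry (cong₂ gauss)) (λ eq → cong re eq , cong im eq)
       ((a ℤ.≟ c) ×-dec (b ℤ.≟ d))

open DecMembership _≟_ using (_∈?_)

-- Used to bring the two unit factors of a twisted product next to each other, where they cancel.
*-interchange : ∀ w x y z → (w * x) * (y * z) ≡ (w * y) * (x * z)
*-interchange (gauss a b) (gauss c d) (gauss e f) (gauss g h) =
  cong₂ gauss (real a b c d e f g h) (imag a b c d e f g h)
  where
  real : ∀ a b c d e f g h →
    (a ℤ.* c ℤ.- b ℤ.* d) ℤ.* (e ℤ.* g ℤ.- f ℤ.* h)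
      ℤ.- (a ℤ.* d ℤ.+ b ℤ.* c) ℤ.* (e ℤ.* h ℤ.+ f ℤ.* g)
    ≡ (a ℤ.* e ℤ.- b ℤ.* f) ℤ.* (c ℤ.* g ℤ.- d ℤ.* h)
      ℤ.- (a ℤ.* f ℤ.+ b ℤ.* e) ℤ.* (c ℤ.* h ℤ.+ d ℤ.* g)
  real = solve-∀

  imag : ∀ a b c d e f g h →
    (a ℤ.* c ℤ.- b ℤ.* d) ℤ.* (e ℤ.* h ℤ.+ f ℤ.* g)
      ℤ.+ (a ℤ.* d ℤ.+ b ℤ.* c) ℤ.* (e ℤ.* g ℤ.- f ℤ.* h)
    ≡ (a ℤ.* e ℤ.- b ℤ.* f) ℤ.* (c ℤ.* h ℤ.+ d ℤ.* g)
      ℤ.+ (a ℤ.* f ℤ.+ b ℤ.* e) ℤ.* (c ℤ.* g ℤ.- d ℤ.* h)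
  imag = solve-∀

*-identityˡ : ∀ z → 1 * z ≡ z
*-identityˡ (gauss a b) = cong₂ gauss (real a b) (imag a b)
  where
  real : ∀ a b → 1ℤ ℤ.* a ℤ.- 0ℤ ℤ.* b ≡ a
  real = solve-∀

  imag : ∀ a b → 1ℤ ℤ.* b ℤ.+ 0ℤ ℤ.* a ≡ b
  imag = solve-∀

*-identityʳ : ∀ z → z * 1 ≡ z
*-identityʳ (gauss a b) = cong₂ gauss (real a b) (imag a b)
  where
  real : ∀ a b → a ℤ.* 1ℤ ℤ.- b ℤ.* 0ℤ ≡ a
  real = solve-∀

  imag : ∀ a b → a ℤ.* 0ℤ ℤ.+ b ℤ.* 1ℤ ≡ b
  imag = solve-∀

*-zeroˡ : ∀ z → 0 * z ≡ 0
*-zeroˡ (gauss a b) = refl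

conj-* : ∀ x y → conj x * conj y ≡ conj (x * y)
conj-* (gauss a b) (gauss c d) = cong₂ gauss (real a b c d) (imag a b c d)
  where
  real : ∀ a b c d → a ℤ.* c ℤ.- (ℤ.- b) ℤ.* (ℤ.- d) ≡ a ℤ.* c ℤ.- b ℤ.* d
  real = solve-∀

  imag : ∀ a b c d →
    a ℤ.* (ℤ.- d) ℤ.+ (ℤ.- b) ℤ.* c ≡ ℤ.- (a ℤ.* d ℤ.+ b ℤ.* c)
  imag = solve-∀

conj-involutive : ∀ z → conj (conj z) ≡ z
conj-involutive (gauss a b) = cong (gauss a) (ℤ.neg-involutive b)

conj≢0 : ∀ {z} → z ≢ 0 → conj z ≢ 0
conj≢0 {z} z≢0 eq = z≢0 (trans (sym (conj-involutive z)) (cong conj eq))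

unit-inverse : ∀ u → ⟦ u ⟧ * ⟦ u ⁻¹ ⟧ ≡ 1
unit-inverse u₁  = refl
unit-inverse u₋₁ = refl
unit-inverse uᵢ  = refl
unit-inverse u₋ᵢ = refl

twist-* : ∀ u a b → (⟦ u ⟧ * a) * (⟦ u ⁻¹ ⟧ * b) ≡ a * b
twist-* u a b = begin
  (⟦ u ⟧ * a) * (⟦ u ⁻¹ ⟧ * b) ≡⟨ *-interchange ⟦ u ⟧ a ⟦ u ⁻¹ ⟧ b ⟩
  (⟦ u ⟧ * ⟦ u ⁻¹ ⟧) * (a * b) ≡⟨ cong (_* (a * b)) (unit-inverse u) ⟩
  1 * (a * b)                  ≡⟨ *-identityˡ (a * b) ⟩
  a * b                        ∎
  where open ≡-Reasoning

-- The inverse unit undoes the multiplication: `twist-*` with second letter 1 recovers `a` from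
-- `⟦ u ⟧ * a`, so the latter vanishes only if `a` does.
unit*≢0 : ∀ u {a} → a ≢ 0 → ⟦ u ⟧ * a ≢ 0
unit*≢0 u {a} a≢0 eq = a≢0 (begin
  a                            ≡⟨ *-identityʳ a ⟨
  a * 1                        ≡⟨ twist-* u a 1 ⟨
  (⟦ u ⟧ * a) * (⟦ u ⁻¹ ⟧ * 1) ≡⟨ cong (_* (⟦ u ⁻¹ ⟧ * 1)) eq ⟩
  0 * (⟦ u ⁻¹ ⟧ * 1)           ≡⟨ *-zeroˡ (⟦ u ⁻¹ ⟧ * 1) ⟩
  0                            ∎)
  where open ≡-Reasoning

-- The shape of `U` with the list of admissible products left as a parameter, so that a shorter list
-- can describe the closure of `U₁`.
data ZeroOrPair (L : List ℤ[i]) : WordSet where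
  pair : ∀ {a b} → a ≢ 0 → b ≢ 0 → a * b ∈ L → ZeroOrPair L (a ∷ b ∷ [])
  zero : ZeroOrPair L [ 0 ]

-- The word `[ 0 ]` is fixed by both operations and twists keep the product of a pair, so closure of
-- `L` under conjugation is the only condition on the list.
Closure⊆ZeroOrPair : ∀ {L X} → All (λ z → conj z ∈ L) L →
                     X ⊆ ZeroOrPair L → Closure X ⊆ ZeroOrPair L
Closure⊆ZeroOrPair {L} {X} conj-closed X⊆ = closed
  where
  conj-pres : ∀ {w} → ZeroOrPair L w → ZeroOrPair L (List⁺.map conj w)
  conj-pres zero = zero
  conj-pres (pair {a} {b} a≢0 b≢0 ab∈L) =
    pair (conj≢0 a≢0) (conj≢0 b≢0)
         (subst (_∈ L) (sym (conj-* a b)) (All.lookup conj-closed ab∈L))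

  twist-pres : ∀ u {w} → ZeroOrPair L w → ZeroOrPair L (twist u w)
  -- Splitting on the unit lets `⟦ u ⟧ * 0` compute to 0.
  twist-pres u₁  zero = zero
  twist-pres u₋₁ zero = zero
  twist-pres uᵢ  zero = zero
  twist-pres u₋ᵢ zero = zero
  twist-pres u (pair {a} {b} a≢0 b≢0 ab∈L) =
    pair (unit*≢0 u a≢0) (unit*≢0 (u ⁻¹) b≢0)
         (subst (_∈ L) (sym (twist-* u a b)) ab∈L)

  closed : Closure X ⊆ ZeroOrPair L
  closed (base w∈X)    = X⊆ w∈X
  closed zero          = zero
  closed (conj∈ w∈)    = conj-pres (closed w∈)
  closed (twist∈ u w∈) = twist-pres u (closed w∈)

-- All of products except its last two entries, 3 ± 2i.
products₁ : List ℤ[i]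
products₁ = take 15 products

-- A finite check by evaluation; each listed pair is tested in both orders, which covers the
-- reversed words.
U₁⊆ZeroOrPair : U₁ ⊆ ZeroOrPair products₁
U₁⊆ZeroOrPair = λ where
    (forward  m) → let a≢0 , b≢0 , ab∈ , _ = All.lookup check m in pair a≢0 b≢0 ab∈
    (backward m) → let a≢0 , b≢0 , _ , ba∈ = All.lookup check m in pair b≢0 a≢0 ba∈
  where
  check : All (λ (a , b) → a ≢ 0 × b ≢ 0 × a * b ∈ products₁ × b * a ∈ products₁)
              multisets₁
  check = from-yes (All.all? (λ (a , b) →
    ¬? (a ≟ 0) ×-dec ¬? (b ≟ 0) ×-dec (a * b ∈? products₁) ×-dec (b * a ∈? products₁))
    multisets₁)

-- Since 3 + 2i and its conjugate are dropped together, `products₁` is still closed under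
-- conjugation.
ClosureU₁⊆ : Closure U₁ ⊆ ZeroOrPair products₁
ClosureU₁⊆ = Closure⊆ZeroOrPair
  (from-yes (All.all? (λ z → conj z ∈? products₁) products₁)) U₁⊆ZeroOrPair

ZeroOrPair⊆U : ZeroOrPair products₁ ⊆ U
ZeroOrPair⊆U zero = zero
ZeroOrPair⊆U (pair a≢0 b≢0 ab∈) = pair a≢0 b≢0
  (All.lookup (from-yes (All.all? (_∈? products) products₁)) ab∈)

Ex-mono : ∀ {X Y : WordSet} → X ⊆ Y → Ex X ⊆ Ex Y
Ex-mono X⊆Y b∈Ex n = let w , w∈X , w⊑b = b∈Ex n in w , X⊆Y w∈X , w⊑b

alternating : ContinuedFraction
alternating zero          = 1
alternating (suc zero)    = 3 + 2 * i
alternating (suc (suc n)) = alternating n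

alternating≢0 : ∀ n → alternating n ≢ 0
alternating≢0 zero          ()
alternating≢0 (suc zero)    ()
alternating≢0 (suc (suc n)) = alternating≢0 n

alternating-product : ∀ n → alternating n * alternating (suc n) ≡ 3 + 2 * i
alternating-product zero          = refl
alternating-product (suc zero)    = refl
alternating-product (suc (suc n)) = alternating-product n

alternating∈ExU : Ex U alternating
alternating∈ExU n =
  -- The witness is the first two letters of the tail, at positions 0 and 1.
  _ , pair (alternating≢0 (n ℕ.+ 0)) (alternating≢0 (n ℕ.+ 1)) product∈
    , 0 , 1 , z≤n , refl
  where
  product∈ : alternating (n ℕ.+ 0) * alternating (n ℕ.+ 1) ∈ products
  product∈ rewrite ℕ.+-identityʳ n | ℕ.+-comm n 1 =
    subst (_∈ products) (sym (alternating-product n))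
          (from-yes (3 + 2 * i ∈? products))

-- A nonzero first letter rules out `[ 0 ]`. The rest of the word is described by an equation, so
-- that it can be compared with the computed tail of a slice.
second-letter : ∀ {L x xs} → x ≢ 0 → ZeroOrPair L (x ∷ xs) →
                ∃[ y ] xs ≡ y ∷ [] × x * y ∈ L
second-letter x≢0 zero           = contradiction refl x≢0
second-letter x≢0 (pair _ _ xy∈) = _ , refl , xy∈

slice∉ZeroOrPair : ∀ r s → ¬ ZeroOrPair products₁ (slice alternating r s)
-- Abstracting `s ℕ.∸ r` exposes the letters after the first. If there are none, the tail equation
-- is absurd; otherwise the second letter is the next term of the sequence, and the product is 3 +
-- 2i.
slice∉ZeroOrPair r s w∈ with s ℕ.∸ r | second-letter (alternating≢0 r) w∈
... | suc _ | y , tail≡ , xy∈ = from-no (3 + 2 * i ∈? products₁)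
  (subst (_∈ products₁)
         (trans (cong (alternating r *_) (sym (∷-injectiveˡ tail≡))) product≡)
         xy∈)
  where
  product≡ : alternating r * alternating (suc (r ℕ.+ 0)) ≡ 3 + 2 * i
  product≡ rewrite ℕ.+-identityʳ r = alternating-product r

alternating∉ExU₁ : ¬ Ex (Closure U₁) alternating
-- The tail from 0, which is the whole sequence by computation, already gives the contradiction.
alternating∉ExU₁ alternating∈ with alternating∈ 0
... | w , w∈ , r , s , _ , refl = slice∉ZeroOrPair r s (ClosureU₁⊆ w∈)

corollaryE : Ex (Closure U₁) ⊂ Ex U
corollaryE = (λ {b} → Ex-mono (ZeroOrPair⊆U ∘ ClosureU₁⊆) {b})
           , λ ExU⊆ → alternating∉ExU₁ (ExU⊆ {alternating} alternating∈ExU)
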